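{- Let $P$ be a poset. If $P$ is well-quasi-ordered and the quasi-ordered set $(S_\omega(P);\leq_{dom})$ is better-quasi-ordered, then $P$ is better-quasi-ordered.
   Context: $S_\omega(P)$ is the set of strictly increasing sequences $x_0<x_1<\cdots$ of elements of $P$, each identified with its set of terms. For subsets $X,Y\subseteq P$, $X\leq_{dom} Y$ means that for every $x\in X$ there is $y\in Y$ with $x\leq y$ (a quasi-order). A quasi-ordered set is well-quasi-ordered (wqo) if it is well-founded and has no infinite antichain. Barriers and bqo: finite subsets of $\mathbb{N}$ are identified with their increasing enumerations. For finite $s,t\subseteq\mathbb{N}$ write $s\triangleleft t$ if there is a finite $r\subseteq\mathbb{N}$ such that $s$ is a proper initial segment of $r$ and $t$ is $r$ with its least element removed. A barrier is an infinite set $B$ of finite subsets of $\mathbb{N}$, no member of which is a proper subset of another, such that every infinite $X\subseteq\bigcup B$ has a nonempty initial segment belonging to $B$. A barrier is well-ordered by the lexicographic order; its order type is the type of this well-order. A map $f$ from a barrier $B$ into a quasi-ordered set $Q$ is good if there exist $s,t\in B$ with $s\triangleleft t$ and $f(s)\leq f(t)$, and bad otherwise. For a countable ordinal $\alpha$, $Q$ is $\alpha$-better-quasi-ordered ($\alpha$-bqo) if every map from a barrier of order type at most $\alpha$ into $Q$ is good; $Q$ is better-quasi-ordered (bqo) if it is $\alpha$-bqo for every countable ordinal $\alpha$. -}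

module Defs where

open import Data.List.Base using (List; []; _∷_; _++_)
open import Data.List.Membership.Propositional using () renaming (_∈_ to _∈ˡ_)
open import Data.List.Relation.Binary.Lex.Strict using (Lex-<)
open import Data.List.Relation.Binary.Subset.Propositional using () renaming (_⊆_ to _⊆ˡ_)
open import Data.List.Relation.Unary.Linked using (Linked)
open import Data.Nat.Base using (ℕ; suc; _<_)
open import Data.Product.Base using (Σ; ∃; ∃₂; _×_; _,_)
open import Data.Refinement.Base using (Refinement; value)
open import Function.Bundles using (_↣_)
open import Induction.WellFounded using (WellFounded)
open import Level using (Level; 0ℓ; _⊔_) renaming (suc to lsuc)
open import Relation.Binary.Bundles using (Poset; Preorder)
open import Relation.Binary.Core using (Rel)
open import Relation.Binary.Structures using (IsStrictTotalOrder)
open import Relation.Binary.PropositionalEquality using (_≡_; _≢_)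
open import Relation.Nullary.Negation.Core using (¬_)
open import Relation.Unary using (Pred; _∈_; _⊆_; _≐_)
import Relation.Binary.Properties.Poset as PosetProperties

private
  variable
    a c ℓ ℓ₁ ℓ₂ : Level

module _ (Q : Preorder c ℓ₁ ℓ₂) where
  open Preorder Q using (Carrier; _≲_)

  StrictPart : Rel Carrier ℓ₂
  StrictPart x y = x ≲ y × ¬ (y ≲ x)

  -- An infinite antichain is given by a sequence of pairwise incomparable
  -- elements; such a sequence is automatically injective.
  InfiniteAntichain : Set (c ⊔ ℓ₂)
  InfiniteAntichain =
    Σ (ℕ → Carrier) λ x → ∀ {i j} → i ≢ j → ¬ (x i ≲ x j)

  WQO : Set (c ⊔ ℓ₂)
  WQO = WellFounded StrictPart × ¬ InfiniteAntichain

module _ {A : Set a} where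

  Finite : Pred A ℓ → Set (a ⊔ ℓ)
  Finite X = ∃ λ (xs : List A) → ∀ {x} → x ∈ X → x ∈ˡ xs

  Infinite : Pred A ℓ → Set (a ⊔ ℓ)
  Infinite X = ¬ Finite X

-- A finite subset of ℕ is represented by its increasing enumeration, so that
-- propositional equality of increasing lists is equality of finite subsets.
Increasing : Pred (List ℕ) 0ℓ
Increasing = Linked _<_

infix 4 _⊂ˡ_ _⊏_ _◁_ _<lex_

_⊂ˡ_ : Rel (List ℕ) 0ℓ
s ⊂ˡ t = s ⊆ˡ t × ¬ (t ⊆ˡ s)

_⊏_ : Rel (List ℕ) 0ℓ
s ⊏ r = ∃₂ λ x xs → r ≡ s ++ x ∷ xs

-- The head of an increasing list is its least element.
_◁_ : Rel (List ℕ) 0ℓ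
s ◁ t = ∃ λ r → Increasing r × s ⊏ r × ∃ λ x → r ≡ x ∷ t

_<lex_ : Rel (List ℕ) 0ℓ
_<lex_ = Lex-< _≡_ _<_

IsInitialSegmentOf : List ℕ → Pred ℕ 0ℓ → Set
IsInitialSegmentOf s X =
  (∀ {n} → n ∈ˡ s → n ∈ X) × (∀ {m n} → m ∈ X → n ∈ˡ s → m < n → m ∈ˡ s)

⋃ : Pred (List ℕ) 0ℓ → Pred ℕ 0ℓ
⋃ B n = ∃ λ s → s ∈ B × n ∈ˡ s

-- Set-level predicates represent all subsets of ℕ and of List ℕ: under excluded
-- middle a predicate of any level is equivalent to a Boolean-valued one.
record IsBarrier (B : Pred (List ℕ) 0ℓ) : Set₁ where
  field
    increasing : B ⊆ Increasing
    infinite   : Infinite B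
    antichain  : ∀ {s t} → s ∈ B → t ∈ B → ¬ (s ⊂ˡ t)
    blocks     : ∀ (X : Pred ℕ 0ℓ) → Infinite X → X ⊆ ⋃ B →
                 ∃ λ s → s ≢ [] × IsInitialSegmentOf s X × s ∈ B

-- The proof of membership is irrelevant, so a map out of Member B is a
-- single-valued function on the set B.
Member : Pred (List ℕ) 0ℓ → Set
Member B = Refinement (List ℕ) B

-- A countable ordinal is presented as a well-ordered type that injects into ℕ
-- (finite ordinals included).
record CountableOrdinal : Set₁ where
  infix 4 _≺_
  field
    Carrier            : Set
    _≺_                : Rel Carrier 0ℓ
    isStrictTotalOrder : IsStrictTotalOrder _≡_ _≺_
    wellFounded        : WellFounded _≺_
    countable          : Carrier ↣ ℕ

-- (B , <lex) is isomorphic to an initial segment of α.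
OrderTypeAtMost : CountableOrdinal → Pred (List ℕ) 0ℓ → Set
OrderTypeAtMost α B =
  ∃ λ (h : Member B → Carrier) →
    (∀ s t → value s <lex value t → h s ≺ h t) ×
    (∀ s b → b ≺ h s → ∃ λ t → h t ≡ b)
  where open CountableOrdinal α

module _ (Q : Preorder c ℓ₁ ℓ₂) where
  open Preorder Q using (Carrier; _≲_)

  Good : {B : Pred (List ℕ) 0ℓ} → (Member B → Carrier) → Set ℓ₂
  Good f = ∃₂ λ s t → value s ◁ value t × f s ≲ f t

  AlphaBQO : CountableOrdinal → Set (lsuc 0ℓ ⊔ c ⊔ ℓ₂)
  AlphaBQO α = ∀ (B : Pred (List ℕ) 0ℓ) → IsBarrier B → OrderTypeAtMost α B →
               (f : Member B → Carrier) → Good f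

  BQO : Set (lsuc 0ℓ ⊔ c ⊔ ℓ₂)
  BQO = ∀ α → AlphaBQO α

-- Identifying a sequence with its set of terms is the setoid equality of Sω.
module _ (P : Poset c ℓ₁ ℓ₂) where
  open Poset P using (Carrier; _≈_; _≤_; refl; trans)
  open PosetProperties P using () renaming (_<_ to _<ᴾ_)

  infix 4 _≤dom_

  _≤dom_ : Pred Carrier ℓ → Pred Carrier ℓ → Set (c ⊔ ℓ ⊔ ℓ₂)
  X ≤dom Y = ∀ {x} → x ∈ X → ∃ λ y → y ∈ Y × x ≤ y

  IncreasingSequence : Set (c ⊔ ℓ₁ ⊔ ℓ₂)
  IncreasingSequence = Σ (ℕ → Carrier) λ x → ∀ n → x n <ᴾ x (suc n)

  Terms : IncreasingSequence → Pred Carrier ℓ₁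
  Terms (x , _) p = ∃ λ n → p ≈ x n

  Sω : Preorder (c ⊔ ℓ₁ ⊔ ℓ₂) (c ⊔ ℓ₁) (c ⊔ ℓ₁ ⊔ ℓ₂)
  Sω = record
    { Carrier    = IncreasingSequence
    ; _≈_        = λ x y → Terms x ≐ Terms y
    ; _≲_        = λ x y → Terms x ≤dom Terms y
    ; isPreorder = record
      { isEquivalence = record
        { refl  = (λ p → p) , (λ p → p)
        ; sym   = λ (f , g) → g , f
        ; trans = λ (f , g) (h , k) → (λ p → h (f p)) , (λ p → g (k p))
        }
      ; reflexive = λ (f , _) {p} p∈x → p , f p∈x , refl
      ; trans     = λ f g p∈x → let (q , q∈y , p≤q) = f p∈x
                                    (r , r∈z , q≤r) = g q∈y
                                in r , r∈z , trans p≤q q≤r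
      }
    }

{-# OPTIONS --safe #-}
module Submission where

-- Let f : B → P be defined on a barrier.  A diagonal argument along the tree of
-- B, using at each node that every sequence in P has a subsequence which is
-- constant or strictly increasing, yields an infinite X ⊆ ⋃ B such that on X
-- either f is constant, or there is a tree D such that for every branch t of D,
-- f (s) depends only on the element n of s that follows t, and increases strictly
-- with n.  In the first case f is trivially good.  In the second, t is mapped to
-- this increasing sequence; after thinning X the branches of D form a barrier, and
-- as Sω (P) is bqo there are t ◁ t′ whose sequences are comparable.  If n is the
-- element following t in t ∪ t′, then the value at n is at most the value of
-- the second sequence at some m, and lengthening t ∪ {n} and t′ ∪ {m} to members
-- of B gives s ◁ s′ with f (s) ≤ f (s′).

open import Defs
open import Axiom.ExcludedMiddle using (ExcludedMiddle)
open import Data.Empty using (⊥-elim)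
open import Data.Irrelevant using ([_])
open import Data.List.Base using (List; []; _∷_; _++_; map; length; concat; upTo)
open import Data.List.Membership.Propositional using () renaming (_∈_ to _∈ˡ_)
open import Data.List.Membership.Propositional.Properties
  using (∈-++⁺ˡ; ∈-++⁺ʳ; ∈-map⁺; ∈-concat⁺′; ∈-upTo⁺)
open import Data.List.Properties using (∷-injective; ++-assoc; ++-identityʳ)
open import Data.List.Relation.Binary.Lex.Core using (base; this) renaming (next to step)
import Data.List.Relation.Binary.Lex.Strict as Lex
open import Data.List.Relation.Binary.Pointwise using (Pointwise-≡⇒≡; ≡⇒Pointwise-≡)
open import Data.List.Relation.Binary.Subset.Propositional using () renaming (_⊆_ to _⊆ˡ_)
open import Data.List.Relation.Unary.Any using (here; there)
open import Data.List.Relation.Unary.Linked using ([]; [-]; _∷_)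
open import Data.Nat.Base using (ℕ; zero; suc; _+_; _≤_; _<_; z≤n; s≤s)
open import Data.Nat.Induction using (<-wellFounded)
open import Data.Nat.Properties
open import Data.Product.Base using (∃; ∃₂; _×_; _,_; proj₁; proj₂)
open import Data.Refinement.Base using (value; _,_)
open import Data.Sum.Base using (_⊎_; inj₁; inj₂)
open import Data.Unit.Polymorphic.Base using (⊤)
open import Function.Base using (_∘_; id)
open import Function.Bundles using (mk↣)
open import Induction.WellFounded using (WellFounded; Acc; acc)
open import Level using (Level; 0ℓ; _⊔_) renaming (suc to lsuc)
open import Relation.Binary.Bundles using (Poset)
open import Relation.Binary.Core using (Rel)
open import Relation.Binary.Definitions using (Trichotomous; tri<; tri≈; tri>)
import Relation.Binary.Properties.Poset as PosetProperties
open import Relation.Binary.PropositionalEquality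
  using (_≡_; _≢_; refl; sym; trans; cong; subst; subst₂; isEquivalence; module ≡-Reasoning)
open import Relation.Binary.Structures using (IsStrictTotalOrder)
open import Relation.Binary.Structures.Biased using (isStrictTotalOrderᶜ)
open import Relation.Nullary.Decidable using (yes; no; recompute; True; toWitness; fromWitness)
open import Relation.Nullary.Negation using (¬_; contradiction)
open import Relation.Unary using (Pred; _∈_; _⊆_)

private
  variable
    a ℓ : Level

-- Unbounded sets of natural numbers and fusion

infixl 30 _/_ _//_

_/_ : Pred ℕ 0ℓ → ℕ → Pred ℕ 0ℓ
(X / n) m = X m × n < m

_//_ : Pred ℕ 0ℓ → List ℕ → Pred ℕ 0ℓ
X // []      = X
X // (n ∷ s) = (X / n) // s

-- A positive counterpart of `Infinite`: it supplies elements, where `Infinite` only refutes a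
-- finite cover.
Unbounded : Pred ℕ 0ℓ → Set
Unbounded X = ∀ n → ∃ λ m → n < m × X m

UnboundedSubset : Pred ℕ 0ℓ → (Pred ℕ 0ℓ → Set ℓ) → Set (lsuc 0ℓ ⊔ ℓ)
UnboundedSubset X Φ = ∃ λ Y → Unbounded Y × Y ⊆ X × Φ Y

/-mono : ∀ {X Y n} → X ⊆ Y → X / n ⊆ Y / n
/-mono X⊆Y (x , n<m) = X⊆Y x , n<m

//-mono : ∀ {X Y} s → X ⊆ Y → X // s ⊆ Y // s
//-mono []      X⊆Y = X⊆Y
//-mono {X} (n ∷ s) X⊆Y = //-mono s (/-mono {X} X⊆Y)

/-unbounded : ∀ {X} n → Unbounded X → Unbounded (X / n)
/-unbounded n X∞ k with m , n+k<m , x ← X∞ (n + k) =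
  m , ≤-<-trans (m≤n+m k n) n+k<m , x , ≤-<-trans (m≤m+n n k) n+k<m

//-unbounded : ∀ {X} s → Unbounded X → Unbounded (X // s)
//-unbounded []      X∞ = X∞
//-unbounded (n ∷ s) X∞ = //-unbounded s (/-unbounded n X∞)

-- The common scheme behind enumerating a set, fusion, and building an infinite set that avoids a
-- barrier. The state carries whatever invariant each of these needs.
module Iterate {St : Set a} (Dom : St → Pred ℕ 0ℓ) (pick : St → ℕ) (next : St → St)
  (pick-∈ : ∀ S → Dom S (pick S)) (next-⊆ : ∀ S → Dom (next S) ⊆ Dom S / pick S) where

  seq : St → ℕ → ℕ
  seq S zero    = pick S
  seq S (suc i) = seq (next S) i

  Range : St → Pred ℕ 0ℓ
  Range S m = ∃ λ i → seq S i ≡ m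

  seq-∈ : ∀ S i → Dom S (seq S i)
  seq-∈ S zero    = pick-∈ S
  seq-∈ S (suc i) = proj₁ (next-⊆ S (seq-∈ (next S) i))

  pick< : ∀ S i → pick S < seq S (suc i)
  pick< S i = proj₂ (next-⊆ S (seq-∈ (next S) i))

  seq-step : ∀ S i → seq S i < seq S (suc i)
  seq-step S zero    = pick< S 0
  seq-step S (suc i) = seq-step (next S) i

  seq-mono : ∀ S {i j} → i < j → seq S i < seq S j
  seq-mono S {zero}  {suc j} _         = pick< S j
  seq-mono S {suc i} {suc j} (s≤s i<j) = seq-mono (next S) i<j

  seq-≥ : ∀ S i → i ≤ seq S i
  seq-≥ S zero    = z≤n
  seq-≥ S (suc i) = ≤-<-trans (seq-≥ S i) (seq-step S i)

  Range-unbounded : ∀ S → Unbounded (Range S)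
  Range-unbounded S n = _ , seq-≥ S (suc n) , suc n , refl

  Range-⊆ : ∀ S → Range S ⊆ Dom S
  Range-⊆ S (i , refl) = seq-∈ S i

  Range-tail : ∀ S → Range S / pick S ⊆ Range (next S)
  Range-tail S ((zero  , refl) , p<p) = contradiction p<p (<-irrefl refl)
  Range-tail S ((suc i , refl) , _)   = i , refl

element : ∃ Unbounded → ℕ
element (X , X∞) = proj₁ (X∞ 0)

element-∈ : ∀ (S : ∃ Unbounded) → proj₁ S (element S)
element-∈ (X , X∞) = proj₂ (proj₂ (X∞ 0))

module Enumerate (X : Pred ℕ 0ℓ) (X∞ : Unbounded X) where

  private
    rest : ∃ Unbounded → ∃ Unbounded
    rest S = proj₁ S / element S , /-unbounded (element S) (proj₂ S)

  open Iterate proj₁ element rest element-∈ (λ _ → id)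

  enum : ℕ → ℕ
  enum = seq (X , X∞)

  enum-∈ : ∀ i → X (enum i)
  enum-∈ = seq-∈ (X , X∞)

  enum-mono : ∀ {i j} → i < j → enum i < enum j
  enum-mono = seq-mono (X , X∞)

  enum-≥ : ∀ i → i ≤ enum i
  enum-≥ = seq-≥ (X , X∞)

-- Fusion: pick `n`, shrink what remains until `R n` holds, and pick again. All later picks lie in
-- the set refined for `n`, so heredity gives `R n` on the tail.
diagonalise : (R : ℕ → Pred ℕ 0ℓ → Set ℓ) →
  (∀ {n X Y} → Y ⊆ X → R n X → R n Y) →
  (∀ n X → Unbounded X → UnboundedSubset X (R n)) →
  ∀ X → Unbounded X → UnboundedSubset X λ Y → ∀ n → Y n → R n (Y / n)
diagonalise R hereditary refinable X X∞ =
  Range start , Range-unbounded start , Range-⊆ start , λ { _ (i , refl) → tail start i }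
  where
  module _ (S : ∃ Unbounded) where
    refined : UnboundedSubset (proj₁ S / element S) (R (element S))
    refined = refinable (element S) _ (/-unbounded (element S) (proj₂ S))
    next : ∃ Unbounded
    next = proj₁ refined , proj₁ (proj₂ refined)
  open Iterate proj₁ element next element-∈
    (λ S → proj₁ (proj₂ (proj₂ (refined S))))
  start = X , X∞
  tail : ∀ S i → R (seq S i) (Range S / seq S i)
  tail S zero    = hereditary (Range-⊆ (next S) ∘ Range-tail S)
    (proj₂ (proj₂ (proj₂ (refined S))))
  tail S (suc i) = hereditary later (tail (next S) i)
    where
    later : Range S / seq S (suc i) ⊆ Range (next S) / seq (next S) i
    later (m∈ , s<m) = Range-tail S (m∈ , <-trans (pick< S i) s<m) , s<m

-- Well-founded trees and their branches

data Tree : Set where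
  leaf : Tree
  node : (ℕ → Tree) → Tree

-- A node has a child for every natural number, so one tree serves all sets `X`; only the increasing
-- paths with labels in `X` count as branches.
data Branch (X : Pred ℕ 0ℓ) : Tree → List ℕ → Set where
  []  : Branch X leaf []
  _∷_ : ∀ {n k s} → X n → Branch (X / n) (k n) s → Branch X (node k) (n ∷ s)

Branch-mono : ∀ {X Y T s} → X ⊆ Y → Branch X T s → Branch Y T s
Branch-mono X⊆Y []      = []
Branch-mono {X} X⊆Y (x ∷ p) = X⊆Y x ∷ Branch-mono (/-mono {X} X⊆Y) p

data Ascent (X : Pred ℕ 0ℓ) : List ℕ → Set where
  []  : Ascent X []
  _∷_ : ∀ {n s} → X n → Ascent (X / n) s → Ascent X (n ∷ s)

Ascent-mono : ∀ {X Y s} → X ⊆ Y → Ascent X s → Ascent Y s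
Ascent-mono X⊆Y []      = []
Ascent-mono {X} X⊆Y (x ∷ p) = X⊆Y x ∷ Ascent-mono (/-mono {X} X⊆Y) p

Ascent-∈ : ∀ {X s m} → Ascent X s → m ∈ˡ s → X m
Ascent-∈ (x ∷ p) (here refl) = x
Ascent-∈ (x ∷ p) (there m∈s) = proj₁ (Ascent-∈ p m∈s)

Ascent-raise : ∀ {X n y s} → n < y → Ascent X (y ∷ s) → Ascent (X / n) (y ∷ s)
Ascent-raise n<y (x ∷ p) =
  (x , n<y) ∷ Ascent-mono (λ (x′ , y<m) → (x′ , <-trans n<y y<m) , y<m) p

Ascent-∷ʳ : ∀ {X s m} → Ascent X s → (X // s) m → Ascent X (s ++ m ∷ [])
Ascent-∷ʳ []      x  = x ∷ []
Ascent-∷ʳ (x ∷ p) x′ = x ∷ Ascent-∷ʳ p x′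

Branch⇒Ascent : ∀ {X T s} → Branch X T s → Ascent X s
Branch⇒Ascent []      = []
Branch⇒Ascent (x ∷ b) = x ∷ Branch⇒Ascent b

Ascent⇒Increasing : ∀ {X s} → Ascent X s → Increasing s
Ascent⇒Increasing []                        = []
Ascent⇒Increasing (x ∷ [])                  = [-]
Ascent⇒Increasing (x ∷ p@((_ , x<y) ∷ _))  = x<y ∷ Ascent⇒Increasing p

Increasing⇒Ascent : ∀ {X s} → Increasing s → (∀ {m} → m ∈ˡ s → X m) → Ascent X s
Increasing⇒Ascent []          s⊆X = []
Increasing⇒Ascent [-]         s⊆X = s⊆X (here refl) ∷ []
Increasing⇒Ascent (x<y ∷ s↑) s⊆X =
  s⊆X (here refl) ∷ Ascent-raise x<y (Increasing⇒Ascent s↑ (s⊆X ∘ there))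

Branch-restrict : ∀ {X Y T s} → Branch X T s → (∀ {m} → m ∈ˡ s → Y m) → Branch Y T s
Branch-restrict []      s⊆Y = []
Branch-restrict (x ∷ b) s⊆Y = s⊆Y (here refl) ∷
  Branch-restrict b (λ m∈s → s⊆Y (there m∈s) , proj₂ (Ascent-∈ (Branch⇒Ascent b) m∈s))

-- Induction on the length of the interval, splitting by whether the list begins with `a`. Hence a
-- barrier with bounded union would be finite.
Ascent-finite : ∀ d a → Finite (Ascent λ m → a ≤ m × m < a + d)
Ascent-finite zero    a = [] ∷ [] , λ where
  []                  → here refl
  ((a≤m , m<a+0) ∷ _) → contradiction (subst (_ <_) (+-identityʳ a) m<a+0) (≤⇒≯ a≤m)
Ascent-finite (suc d) a with xs , complete ← Ascent-finite d (suc a) =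
  xs ++ map (a ∷_) xs , λ p → cover p
  where
  shift : ∀ {m} → (a ≤ m × m < a + suc d) × a < m → suc a ≤ m × m < suc a + d
  shift {m} ((_ , m<) , a<m) = a<m , subst (m <_) (+-suc a d) m<
  cover : ∀ {s} → Ascent (λ m → a ≤ m × m < a + suc d) s → s ∈ˡ xs ++ map (a ∷_) xs
  cover []                      = ∈-++⁺ˡ (complete [])
  cover ((a≤m , m<) ∷ p) with m≤n⇒m<n∨m≡n a≤m
  ... | inj₁ a<m  = ∈-++⁺ˡ (complete (Ascent-mono shift (Ascent-raise a<m ((a≤m , m<) ∷ p))))
  ... | inj₂ refl = ∈-++⁺ʳ xs (∈-map⁺ (a ∷_) (complete (Ascent-mono shift p)))

∈-tail : ∀ {m n s} → n < m → m ∈ˡ n ∷ s → m ∈ˡ s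
∈-tail n<m (here refl) = contradiction n<m (<-irrefl refl)
∈-tail n<m (there m∈s) = m∈s

⊆-length : ∀ {X Y s t} → Ascent X s → Ascent Y t → s ⊆ˡ t → s ≡ t ⊎ length s < length t
⊆-length []      []      s⊆t = inj₁ refl
⊆-length []      (_ ∷ _) s⊆t = inj₂ (s≤s z≤n)
⊆-length (_ ∷ _) []      s⊆t = contradiction (s⊆t (here refl)) λ ()
⊆-length p@(_ ∷ p′) (_ ∷ q) s⊆t with s⊆t (here refl)
... | here refl with ⊆-length p′ q (λ m∈s → ∈-tail (proj₂ (Ascent-∈ p′ m∈s)) (s⊆t (there m∈s)))
...   | inj₁ refl = inj₁ refl
...   | inj₂ s<t  = inj₂ (s≤s s<t)
-- The head of `s` occurs further inside, so `y` is below all of `s`, and `s` is included in the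
-- tail `t`.
⊆-length {s = x ∷ _} {y ∷ t} p@(_ ∷ p′) (_ ∷ q) s⊆t
    | there x∈t with ⊆-length p q tail
    where
    y<x = proj₂ (Ascent-∈ q x∈t)
    tail : ∀ {m} → m ∈ˡ _ → m ∈ˡ t
    tail (here refl) = x∈t
    tail (there m∈s) with s⊆t (there m∈s)
    ... | here refl = contradiction (<-trans y<x (proj₂ (Ascent-∈ p′ m∈s))) (<-irrefl refl)
    ... | there m∈t = m∈t
...   | inj₁ refl = inj₂ (n<1+n _)
...   | inj₂ s<t  = inj₂ (m<n⇒m<1+n s<t)

⊂-length : ∀ {X Y s t} → Ascent X s → Ascent Y t → s ⊂ˡ t → length s < length t
⊂-length p q (s⊆t , t⊈s) with ⊆-length p q s⊆t
... | inj₁ refl = ⊥-elim (t⊈s λ m∈s → m∈s)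
... | inj₂ s<t  = s<t

++-comparable : ∀ s t {u v} → s ++ u ≡ t ++ v → s ⊏ t ⊎ ∃ λ w → s ≡ t ++ w
++-comparable s       []      eq = inj₂ (s , refl)
++-comparable []      (y ∷ t) eq = inj₁ (y , t , refl)
++-comparable (x ∷ s) (y ∷ t) eq with refl , eq′ ← ∷-injective eq with ++-comparable s t eq′
... | inj₁ (z , w , refl) = inj₁ (z , w , refl)
... | inj₂ (w , refl)     = inj₂ (w , refl)

-- Two lists are comparable under the initial segment relation when they have a
-- common extension; here r ++ a.
comparable-branch : ∀ T {X r} → Unbounded X → Ascent X r →
  ∃₂ λ s u → ∃ λ a → Branch X T s × Ascent X (r ++ a) × s ++ u ≡ r ++ a
comparable-branch leaf {r = r} X∞ p =
  [] , r , [] , [] , subst (Ascent _) (sym (++-identityʳ r)) p , sym (++-identityʳ r)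
comparable-branch (node k) X∞ [] with n , _ , x ← X∞ 0
  with s , u , a , b , p , eq ← comparable-branch (k n) (/-unbounded n X∞) [] =
  n ∷ s , u , n ∷ a , x ∷ b , x ∷ p , cong (n ∷_) eq
comparable-branch (node k) X∞ (_∷_ {n} x p)
  with s , u , a , b , p , eq ← comparable-branch (k n) (/-unbounded n X∞) p =
  n ∷ s , u , a , x ∷ b , x ∷ p , cong (n ∷_) eq

-- Take a branch `s` along an extension of `x ∷ r`, then a branch `t` along a further extension with
-- `x` dropped. Both `s` and `x ∷ t` begin the same list. Were `x ∷ t` an initial segment of `s`,
-- then `t` would be a proper subset of `s`, against the antichain condition.
shift-branches : ∀ {T X x r} → Unbounded X →
  (∀ {s t} → Branch X T s → Branch X T t → ¬ (s ⊂ˡ t)) → Ascent X (x ∷ r) →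
  ∃₂ λ s t → s ◁ t × Branch X T s × Branch X T t ×
    ∃₂ λ u v → ∃ λ a → s ++ u ≡ x ∷ r ++ a × t ++ v ≡ r ++ a
shift-branches {T} {X} {x} {r} X∞ antichain p
  with s , u , a , b , x∈ ∷ q , eq ← comparable-branch T X∞ p
  with t , v , a′ , b′ , _ , eq′ ← comparable-branch T (/-unbounded x X∞) q =
  s , t , s◁t , b , Branch-mono proj₁ b′ , u ++ a′ , v , a ++ a′ , eq₁ , eq₂
  where
  open ≡-Reasoning
  eq₂ : t ++ v ≡ r ++ a ++ a′
  eq₂ = trans eq′ (++-assoc r a a′)
  eq₁ : s ++ u ++ a′ ≡ x ∷ r ++ a ++ a′
  eq₁ = begin
    s ++ u ++ a′       ≡⟨ ++-assoc s u a′ ⟨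
    (s ++ u) ++ a′     ≡⟨ cong (_++ a′) eq ⟩
    x ∷ (r ++ a) ++ a′ ≡⟨ cong (x ∷_) (++-assoc r a a′) ⟩
    x ∷ r ++ a ++ a′   ∎
  s◁t : s ◁ t
  s◁t with ++-comparable s (x ∷ t) (trans eq₁ (cong (x ∷_) (sym eq₂)))
  ... | inj₁ s⊏xt = x ∷ t , Ascent⇒Increasing (x∈ ∷ Branch⇒Ascent b′) , s⊏xt , x , refl
  ... | inj₂ (w , refl) = ⊥-elim (antichain (Branch-mono proj₁ b′) b
    ( (λ m∈t → there (∈-++⁺ˡ m∈t))
    , λ s⊆t → <-irrefl refl (proj₂ (Ascent-∈ (Branch⇒Ascent b′) (s⊆t (here refl))))))

-- Bounds, codes of finite lists and the lexicographic order

upperBound : ∀ xs → ∃ λ N → ∀ {m} → m ∈ˡ xs → m ≤ N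
upperBound []       = 0 , λ ()
upperBound (x ∷ xs) with N , ≤N ← upperBound xs = x + N , λ where
  (here refl)  → m≤m+n x N
  (there m∈xs) → ≤-trans (≤N m∈xs) (m≤n+m N x)

unbounded⇒infinite : ∀ {X} → Unbounded X → Infinite X
unbounded⇒infinite X∞ (xs , complete) with N , ≤N ← upperBound xs
  with m , N<m , x ← X∞ N = <⇒≱ N<m (≤N (complete x))

-- This is 2^n (2c + 1): injective by parity, and never 0, which is left as the code of the empty
-- list.
pairing : ℕ → ℕ → ℕ
pairing zero    c = suc (c + c)
pairing (suc n) c = pairing n c + pairing n c

double-injective : ∀ {m n} → m + m ≡ n + n → m ≡ n
double-injective {m} {n} eq with <-cmp m n
... | tri< m<n _ _ = contradiction eq (<⇒≢ (+-mono-< m<n m<n))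
... | tri≈ _ m≡n _ = m≡n
... | tri> _ _ n<m = contradiction (sym eq) (<⇒≢ (+-mono-< n<m n<m))

odd≢even : ∀ m n → suc (m + m) ≢ n + n
odd≢even m (suc n) eq = odd≢even n m (sym (suc-injective (trans eq (cong suc (+-suc n n)))))

pairing-injective : ∀ m n {c d} → pairing m c ≡ pairing n d → m ≡ n × c ≡ d
pairing-injective zero    zero    eq = refl , double-injective (suc-injective eq)
pairing-injective zero    (suc n) {c} {d} eq = contradiction eq (odd≢even c (pairing n d))
pairing-injective (suc m) zero    {c} {d} eq = contradiction (sym eq) (odd≢even d (pairing m c))
pairing-injective (suc m) (suc n) eq with refl , c≡d ← pairing-injective m n (double-injective eq) =
  refl , c≡d

pairing≢0 : ∀ n {c} → pairing n c ≢ 0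
pairing≢0 (suc n) {c} eq = pairing≢0 n (m+n≡0⇒m≡0 (pairing n c) eq)

code : List ℕ → ℕ
code []      = 0
code (n ∷ s) = pairing n (code s)

code-injective : ∀ {s t} → code s ≡ code t → s ≡ t
code-injective {[]}    {[]}    eq = refl
code-injective {[]}    {n ∷ t} eq = contradiction (sym eq) (pairing≢0 n)
code-injective {m ∷ s} {[]}    eq = contradiction eq (pairing≢0 m)
code-injective {m ∷ s} {n ∷ t} eq with refl , eq′ ← pairing-injective m n eq =
  cong (m ∷_) (code-injective eq′)

-- The lexicographic order is not well-founded on all lists, so descent is confined to branches. A
-- step down either lowers the first label, where the new subtree is handled by induction on the
-- tree, or descends within the same subtree.
branches-wellFounded : ∀ T {X s} → Branch X T s → Acc (λ s t → Branch X T s × s <lex t) s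
branches-wellFounded leaf [] = acc λ { ([] , base ()) }
branches-wellFounded (node k) {X} (_∷_ {n} x b) =
  go (<-wellFounded n) (branches-wellFounded (k n) b)
  where
  _⋖_ = λ s t → Branch X (node k) s × s <lex t
  mutual
    go : ∀ {n s} → Acc _<_ n → Acc (λ s t → Branch (X / n) (k n) s × s <lex t) s →
      Acc _⋖_ (n ∷ s)
    go wf-n wf-s = acc (below wf-n wf-s)

    below : ∀ {n s t} → Acc _<_ n → Acc (λ s t → Branch (X / n) (k n) s × s <lex t) s →
      t ⋖ (n ∷ s) → Acc _⋖_ t
    below (acc rn) wf-s     (_∷_ {m} _ b′ , this m<n) =
      go (rn m<n) (branches-wellFounded (k m) b′)
    below wf-n     (acc rs) (_ ∷ b′ , step refl s<)   = go wf-n (rs (b′ , s<))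

prefixed : ∀ {X n w} t → Ascent X (t ++ n ∷ w) → (X // t) n
prefixed []      (x ∷ _) = x
prefixed (_ ∷ t) (_ ∷ p) = prefixed t p

Member-≡ : ∀ {B : Pred (List ℕ) 0ℓ} {s t : Member B} → value s ≡ value t → s ≡ t
Member-≡ {s = _ , _} {_ , _} refl = refl

noDescent : ∀ {A : Set a} {_≺_ : Rel A ℓ} → WellFounded _≺_ →
  (x : ℕ → A) → ¬ (∀ i → x (suc i) ≺ x i)
noDescent {_≺_ = _≺_} wf x x↘ = go 0 (wf (x 0))
  where
  go : ∀ i → ¬ Acc _≺_ (x i)
  go i (acc rs) = go (suc i) (rs (x↘ i))

-- Partition theorems for unbounded sets

module Classical (em : ∀ {ℓ} → ExcludedMiddle ℓ) where

  bounded : ∀ {X} → ¬ Unbounded X → ∃ λ N → ∀ m → N < m → ¬ X m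
  bounded {X} ¬X∞ with em {P = ∃ λ N → ∀ m → N < m → ¬ X m}
  ... | yes p = p
  ... | no ¬p = contradiction X∞ ¬X∞
    where
    X∞ : Unbounded X
    X∞ n with em {P = ∃ λ m → n < m × X m}
    ... | yes q = q
    ... | no ¬q = contradiction (n , λ m n<m x → ¬q (m , n<m , x)) ¬p

  -- True turns Q, of arbitrary level, into a predicate in Set.
  pigeonhole : ∀ (Q : ℕ → Set ℓ) X → Unbounded X →
    UnboundedSubset X λ Y → (∀ n → Y n → Q n) ⊎ (∀ n → Y n → ¬ Q n)
  pigeonhole Q X X∞ with em {P = Unbounded (λ n → X n × True (em {P = Q n}))}
  ... | yes Y∞ = _ , Y∞ , proj₁ , inj₁ λ _ y → toWitness (proj₂ y)
  ... | no ¬Y∞ with N , N< ← bounded ¬Y∞ =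
    X / N , /-unbounded N X∞ , proj₁ ,
    inj₂ λ _ (x , N<n) q → N< _ N<n (x , fromWitness q)

  abstract
    -- Induction on the tree: fusion makes the branches through each `n` monochromatic, and the
    -- pigeonhole principle makes their colour independent of `n`.
    nashWilliams : ∀ T (Q : List ℕ → Set ℓ) X → Unbounded X →
      UnboundedSubset X λ Y → (∀ s → Branch Y T s → Q s) ⊎ (∀ s → Branch Y T s → ¬ Q s)
    nashWilliams leaf Q X X∞ with em {P = Q []}
    ... | yes q = X , X∞ , id , inj₁ λ { _ [] → q }
    ... | no ¬q = X , X∞ , id , inj₂ λ { _ [] → ¬q }
    nashWilliams (node k) Q X X∞
      with Y , Y∞ , Y⊆X , below ← diagonalise
        (λ n Y → (∀ s → Branch Y (k n) s → Q (n ∷ s)) ⊎ (∀ s → Branch Y (k n) s → ¬ Q (n ∷ s)))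
        (λ { Y⊆X (inj₁ q) → inj₁ λ s → q s ∘ Branch-mono Y⊆X
           ; Y⊆X (inj₂ q) → inj₂ λ s → q s ∘ Branch-mono Y⊆X })
        (λ n → nashWilliams (k n) (Q ∘ (n ∷_))) X X∞
      with pigeonhole (λ n → ∀ s → Branch (Y / n) (k n) s → Q (n ∷ s)) Y Y∞
    ... | Z , Z∞ , Z⊆Y , inj₁ all = Z , Z∞ , Y⊆X ∘ Z⊆Y , inj₁ λ {
      _ (z ∷ b) → all _ z _ (Branch-mono (/-mono {Z} Z⊆Y) b) }
    ... | Z , Z∞ , Z⊆Y , inj₂ ¬all = Z , Z∞ , Y⊆X ∘ Z⊆Y , inj₂ λ {
      _ (z ∷ b) → none _ z _ (Branch-mono (/-mono {Z} Z⊆Y) b) }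
      where
      none : ∀ n → Z n → ∀ s → Branch (Y / n) (k n) s → ¬ Q (n ∷ s)
      none n z with below n (Z⊆Y z)
      ... | inj₁ q = contradiction q (¬all n z)
      ... | inj₂ q = q

  ramsey : ∀ (R : ℕ → ℕ → Set ℓ) X → Unbounded X →
    UnboundedSubset X λ Y →
      (∀ {m n} → Y m → Y n → m < n → R m n) ⊎ (∀ {m n} → Y m → Y n → m < n → ¬ R m n)
  ramsey {ℓ} R X X∞ with nashWilliams (node λ _ → node λ _ → leaf) Q X X∞
    where
    Q : List ℕ → Set ℓ
    Q (m ∷ n ∷ []) = R m n
    -- Never reached: every branch of this tree has length two.
    Q _            = ⊤
  ... | Y , Y∞ , Y⊆X , inj₁ q = Y , Y∞ , Y⊆X , inj₁ λ m n m<n → q _ (m ∷ (n , m<n) ∷ [])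
  ... | Y , Y∞ , Y⊆X , inj₂ q = Y , Y∞ , Y⊆X , inj₂ λ m n m<n → q _ (m ∷ (n , m<n) ∷ [])

  choose : ∀ {B : Set a} {X : Pred ℕ 0ℓ} {Φ : ℕ → B → Set ℓ} → B →
    (∀ n → X n → ∃ (Φ n)) → ∃ λ (f : ℕ → B) → ∀ n → X n → Φ n (f n)
  choose {B = B} {X} {Φ} default pick = (λ n → proj₁ (total n)) , λ n → proj₂ (total n)
    where
    total : ∀ n → ∃ λ b → X n → Φ n b
    total n with em {P = X n}
    ... | yes x = let b , φ = pick n x in b , λ _ → φ
    ... | no ¬x = default , λ x → contradiction x ¬x

  -- Barriers formed by the branches of a tree

  infinite⇒unbounded : ∀ {X} → Infinite X → Unbounded X
  infinite⇒unbounded {X} X-inf with em {P = Unbounded X}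
  ... | yes X∞ = X∞
  ... | no ¬X∞ with N , N< ← bounded ¬X∞ =
    contradiction (upTo (suc N) , λ x → ∈-upTo⁺ (s≤s (≮⇒≥ λ N<m → N< _ N<m x))) X-inf

  least : ∀ {X : Pred ℕ 0ℓ} {n} → X n → ∃ λ m → X m × ∀ {k} → X k → m ≤ k
  least {X} = go (<-wellFounded _)
    where
    go : ∀ {n} → Acc _<_ n → X n → ∃ λ m → X m × ∀ {k} → X k → m ≤ k
    go {n} (acc rs) x with em {P = ∃ λ k → k < n × X k}
    ... | yes (k , k<n , x′) = go (rs k<n) x′
    ... | no ¬smaller        = n , x , λ x′ → ≮⇒≥ λ k<n → ¬smaller (_ , k<n , x′)

  -- Descend the tree along the least remaining element of `X`.
  initial-branch : ∀ T {X} → Unbounded X → ∃ λ s → Branch X T s × IsInitialSegmentOf s X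
  initial-branch leaf     X∞ = [] , [] , (λ ()) , λ _ ()
  initial-branch (node k) {X} X∞ with n , x , n≤ ← least (proj₂ (proj₂ (X∞ 0)))
    with s , b , _ , initial ← initial-branch (k n) (/-unbounded n X∞) =
    n ∷ s , x ∷ b , Ascent-∈ (x ∷ Branch⇒Ascent b) , λ where
      x′ (here refl) m<n → contradiction (n≤ x′) (<⇒≱ m<n)
      x′ (there i∈s) m<i → closed x′ i∈s m<i (m≤n⇒m<n∨m≡n (n≤ x′))
    where
    closed : ∀ {m i} → X m → i ∈ˡ s → m < i → n < m ⊎ n ≡ m → m ∈ˡ n ∷ s
    closed x′ i∈s m<i (inj₁ n<m)  = there (initial (x′ , n<m) i∈s m<i)
    closed x′ i∈s m<i (inj₂ refl) = here refl

  -- Colour a branch by whether it properly contains another one.  A set on which every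
  -- branch does would give an infinite descent of lengths.
  thin : ∀ T X → Unbounded X → UnboundedSubset X λ Y →
    ∀ {s t} → Branch Y T s → Branch Y T t → ¬ (s ⊂ˡ t)
  thin T X X∞ with nashWilliams T (λ t → ∃ λ s → Branch X T s × s ⊂ˡ t) X X∞
  ... | Y , Y∞ , Y⊆X , inj₂ minimal = Y , Y∞ , Y⊆X ,
    λ b b′ s⊂t → minimal _ b′ (_ , Branch-mono Y⊆X b , s⊂t)
  ... | Y , Y∞ , Y⊆X , inj₁ nonminimal =
    ⊥-elim (descend (<-wellFounded _) (proj₁ (proj₂ (initial-branch T Y∞))))
    where
    descend : ∀ {t} → Acc _<_ (length t) → ¬ Branch Y T t
    descend (acc rs) b with s , b′ , s⊂t ← nonminimal _ b =
      descend (rs (⊂-length (Branch⇒Ascent b′) (Branch⇒Ascent b) s⊂t))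
        (Branch-restrict b′ (Ascent-∈ (Branch⇒Ascent b) ∘ proj₁ s⊂t))

  -- A node at the root excludes the empty branch and gives branches with arbitrarily large first
  -- labels. A set inside the union lies inside `X`, so its own initial branch blocks it.
  node-isBarrier : ∀ {k X} → Unbounded X →
    (∀ {s t} → Branch X (node k) s → Branch X (node k) t → ¬ (s ⊂ˡ t)) →
    IsBarrier (Branch X (node k))
  node-isBarrier {k} {X} X∞ antichain = record
    { increasing = Ascent⇒Increasing ∘ Branch⇒Ascent
    ; infinite   = infinite
    ; antichain  = antichain
    ; blocks     = blocks
    }
    where
    infinite : Infinite (Branch X (node k))
    infinite (xs , complete) with N , ≤N ← upperBound (concat xs) with n , N<n , x ← X∞ N
      with s , b , _ ← initial-branch (k n) (/-unbounded n X∞) =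
      <⇒≱ N<n (≤N (∈-concat⁺′ (here refl) (complete (x ∷ b))))
    blocks : ∀ Y → Infinite Y → Y ⊆ ⋃ (Branch X (node k)) →
      ∃ λ s → s ≢ [] × IsInitialSegmentOf s Y × s ∈ Branch X (node k)
    blocks Y Y-inf Y⊆⋃
      with initial-branch (node k) (infinite⇒unbounded Y-inf)
    ... | s , b@(_ ∷ _) , initial = s , (λ ()) , initial , Branch-mono Y⊆X b
      where
      Y⊆X : Y ⊆ X
      Y⊆X y with _ , b , n∈s ← Y⊆⋃ y = Ascent-∈ (Branch⇒Ascent b) n∈s

  Member-∈ : ∀ {B : Pred (List ℕ) 0ℓ} (s : Member B) → B (value s)
  Member-∈ (_ , [ p ]) = recompute em p

  -- The branches present their own order type, so the map that `OrderTypeAtMost` asks for can be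
  -- the identity.
  lexicographic : Pred ℕ 0ℓ → Tree → CountableOrdinal
  lexicographic X T = record
    { Carrier            = Member (Branch X T)
    ; _≺_                = λ s t → value s <lex value t
    ; isStrictTotalOrder = isStrictTotalOrderᶜ record
      { isEquivalence = isEquivalence
      ; trans         = L.trans
      ; compare       = compare
      }
    ; wellFounded        = λ s → lift-Acc s (branches-wellFounded T (Member-∈ s))
    ; countable          = mk↣ (Member-≡ ∘ code-injective)
    }
    where
    module L = IsStrictTotalOrder (Lex.<-isStrictTotalOrder <-isStrictTotalOrder)
    compare : Trichotomous _≡_ λ (s t : Member (Branch X T)) → value s <lex value t
    compare s t with L.compare (value s) (value t)
    ... | tri< s<t s≉t s≯t = tri< s<t (s≉t ∘ ≡⇒Pointwise-≡ ∘ cong value) s≯t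
    ... | tri≈ s≮t s≈t s≯t = tri≈ s≮t (Member-≡ (Pointwise-≡⇒≡ s≈t)) s≯t
    ... | tri> s≮t s≉t s>t = tri> s≮t (s≉t ∘ ≡⇒Pointwise-≡ ∘ cong value) s>t
    lift-Acc : ∀ t → Acc (λ s t → Branch X T s × s <lex t) (value t) →
      Acc (λ (s t : Member (Branch X T)) → value s <lex value t) t
    lift-Acc t (acc rs) = acc λ {s} s<t → lift-Acc s (rs (Member-∈ s , s<t))

  -- Trees inside a given barrier

  ⋃-unbounded : ∀ {B} → IsBarrier B → Unbounded (⋃ B)
  ⋃-unbounded {B} barrier with em {P = Unbounded (⋃ B)}
  ... | yes ⋃∞ = ⋃∞
  ... | no ¬⋃∞ with N , N< ← bounded ¬⋃∞ with xs , complete ← Ascent-finite (suc N) 0 =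
    ⊥-elim (infinite (xs , λ {s} s∈B → complete (Increasing⇒Ascent (increasing s∈B)
      λ m∈s → z≤n , s≤s (≮⇒≥ λ N<m → N< _ N<m (s , s∈B , m∈s)))))
    where open IsBarrier barrier

  -- An inductive witness that `B` blocks `X`; it opens maps on a barrier to structural induction.
  Barred : Pred (List ℕ) 0ℓ → Pred ℕ 0ℓ → Set
  Barred B X = ∃ λ T → ∀ {s} → Branch X T s → B s

  private
    -- If B is not barred on X, iterating extension yields an infinite subset of X without
    -- initial segment in B.
    Unbarred : Set₁
    Unbarred = ∃₂ λ B X → ¬ Barred B X

    -- If every section of `B` were barred, the trees chosen for the sections would be the subtrees
    -- of a tree for `B`.
    extension : ∀ B X → ¬ Barred B X → ∃ λ n → X n × ¬ Barred (B ∘ (n ∷_)) (X / n)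
    extension B X ¬barred with em {P = ∃ λ n → X n × ¬ Barred (B ∘ (n ∷_)) (X / n)}
    ... | yes p = p
    ... | no ¬p = contradiction barred ¬barred
      where
      sub : ∀ n → X n → Barred (B ∘ (n ∷_)) (X / n)
      sub n x with em {P = Barred (B ∘ (n ∷_)) (X / n)}
      ... | yes q = q
      ... | no ¬q = contradiction (n , x , ¬q) ¬p
      barred : Barred B X
      barred with k , k⊆B ← choose {X = X}
        {Φ = λ n T → ∀ {s} → Branch (X / n) T s → B (n ∷ s)} leaf sub =
        node k , λ { (x ∷ b) → k⊆B _ x b }

    pick : Unbarred → ℕ
    pick (B , X , ¬barred) = proj₁ (extension B X ¬barred)

    extend : Unbarred → Unbarred
    extend S@(B , X , ¬barred) =
      B ∘ (pick S ∷_) , X / pick S , proj₂ (proj₂ (extension B X ¬barred))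

    open Iterate (λ (S : Unbarred) → proj₁ (proj₂ S)) pick extend
      (λ (B , X , ¬barred) → proj₁ (proj₂ (extension B X ¬barred))) (λ _ → id)

    prefix : Unbarred → ℕ → List ℕ
    prefix S zero    = []
    prefix S (suc i) = pick S ∷ prefix (extend S) i

    prefix-∉ : ∀ (S : Unbarred) i → ¬ proj₁ S (prefix S i)
    prefix-∉ (B , X , ¬barred) zero    []∈B = ¬barred (leaf , λ { [] → []∈B })
    prefix-∉ S                 (suc i) s∈B  = prefix-∉ (extend S) i s∈B

    initial-prefix : ∀ S {s} → Ascent (Range S) s → IsInitialSegmentOf s (Range S) →
      ∃ λ i → s ≡ prefix S i
    initial-prefix S []                    _             = 0 , refl
    initial-prefix S ((zero , refl) ∷ q)   (_ , initial)
      with i , refl ← initial-prefix (extend S) (Ascent-mono (Range-tail S) q)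
        ( (λ m∈s → Range-tail S (Ascent-∈ q m∈s))
        , λ { (j , refl) i∈s m<i →
              ∈-tail (pick< S j) (initial (suc j , refl) (there i∈s) m<i) })
      = suc i , refl
    initial-prefix S ((suc j , refl) ∷ q)  (_ , initial)
      with initial (0 , refl) (here refl) (pick< S j)
    ... | here eq   = contradiction (pick< S j) (<-irrefl eq)
    ... | there p∈s = contradiction (pick< S j) (<-asym (proj₂ (Ascent-∈ q p∈s)))

  barrier-barred : ∀ {B} → IsBarrier B → Barred B (⋃ B)
  barrier-barred {B} barrier with em {P = Barred B (⋃ B)}
  ... | yes barred = barred
  ... | no ¬barred
    with s , _ , initial , s∈B ← IsBarrier.blocks barrier (Range (B , ⋃ B , ¬barred))
      (unbounded⇒infinite (Range-unbounded _)) (Range-⊆ _)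
    with i , refl ← initial-prefix (B , ⋃ B , ¬barred)
      (Increasing⇒Ascent (IsBarrier.increasing barrier s∈B) (proj₁ initial)) initial
    = contradiction s∈B (prefix-∉ (B , ⋃ B , ¬barred) i)

  -- The dichotomy between constant and ascending maps

  module _ {c ℓ₁ ℓ₂} (P : Poset c ℓ₁ ℓ₂) where
    open Poset P using (_≈_; module Eq; reflexive; antisym; preorder)
      renaming (Carrier to A; _≤_ to _≤ᴾ_; trans to ≤ᴾ-trans)
    open PosetProperties P using () renaming (_<_ to _<ᴾ_)

    StrictlyIncreasing : Pred ℕ 0ℓ → (ℕ → A) → Set _
    StrictlyIncreasing X h = ∀ {m n} → X m → X n → m < n → h m <ᴾ h n

    Constant : Tree → (List ℕ → A) → Pred ℕ 0ℓ → Set _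
    Constant T f X = ∃ λ p → ∀ {s} → Branch X T s → f s ≈ p

    -- The equation says that s and t ∪ {n} are comparable initial segments; in the case
    -- of interest t is a proper initial segment of s, and n is the next element of s.
    Ascending : Tree → (List ℕ → A) → Pred ℕ 0ℓ → List ℕ → Set _
    Ascending T f X t = ∃ λ h → StrictlyIncreasing (X // t) h ×
      (∀ {n s u v} → Branch X T s → s ++ u ≡ t ++ n ∷ v → f s ≈ h n)

    Ascends : Tree → (List ℕ → A) → Pred ℕ 0ℓ → Set _
    Ascends T f X = ∃ λ D → ∀ {t} → Branch X D t → Ascending T f X t

    Constant-mono : ∀ {T f X Y} → Y ⊆ X → Constant T f X → Constant T f Y
    Constant-mono Y⊆X (p , f≈p) = p , f≈p ∘ Branch-mono Y⊆X

    Ascending-mono : ∀ {T f X Y} t → Y ⊆ X → Ascending T f X t → Ascending T f Y t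
    Ascending-mono {Y = Y} t Y⊆X (h , h↑ , f≈h) = h ,
      (λ m n → h↑ (//-mono {Y} t Y⊆X m) (//-mono {Y} t Y⊆X n)) , f≈h ∘ Branch-mono Y⊆X

    Ascends-mono : ∀ {T f X Y} → Y ⊆ X → Ascends T f X → Ascends T f Y
    Ascends-mono {T} {f} {X} Y⊆X (D , D↑) =
      D , λ p → Ascending-mono {T} {f} {X} _ Y⊆X (D↑ (Branch-mono Y⊆X p))

    node-ascends : ∀ {k f X} → (∀ n → X n → Ascends (k n) (f ∘ (n ∷_)) (X / n)) →
      Ascends (node k) f X
    node-ascends {k} {f} {X} ascends
      with D , D↑ ← choose {X = X}
        {Φ = λ n D → ∀ {t} → Branch (X / n) D t → Ascending (k n) (f ∘ (n ∷_)) (X / n) t}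
        leaf ascends
      = node D , λ where
          (x ∷ b) → let h , h↑ , f≈h = D↑ _ x b in
            h , h↑ , λ { (_ ∷ b′) eq → below f≈h b′ (∷-injective eq) }
      where
      below : ∀ {m n s t i u v} {h : ℕ → A} →
        (∀ {i s u v} → Branch (X / n) (k n) s → s ++ u ≡ t ++ i ∷ v → f (n ∷ s) ≈ h i) →
        Branch (X / m) (k m) s → m ≡ n × s ++ u ≡ t ++ i ∷ v → f (m ∷ s) ≈ h i
      below f≈h b (refl , eq) = f≈h b eq

    module _ (wqo : WQO preorder) where

      -- Apply Ramsey's theorem to `≤` and then to its converse. Both holding gives a constant by
      -- antisymmetry, the first alone a strict increase; the second alone is an infinite descent
      -- and neither an infinite antichain, both excluded by `wqo`.
      constant-or-increasing : ∀ h X → Unbounded X → UnboundedSubset X λ Y →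
        (∃ λ p → ∀ {n} → Y n → h n ≈ p) ⊎ StrictlyIncreasing Y h
      constant-or-increasing h X X∞
        with Y , Y∞ , Y⊆X , up ← ramsey (λ m n → h m ≤ᴾ h n) X X∞
        with Z , Z∞ , Z⊆Y , down ← ramsey (λ m n → h n ≤ᴾ h m) Y Y∞
        with up | down
      ... | inj₁ h↑ | inj₁ h↓ with n , _ , z ← Z∞ 0 =
        -- The constant is `h n`; only indices above `n` are kept, since homogeneity compares
        -- increasing pairs.
        Z / n , /-unbounded n Z∞ , Y⊆X ∘ Z⊆Y ∘ proj₁ , inj₁ (h n , λ (z′ , n<m) →
          antisym (h↓ z z′ n<m) (h↑ (Z⊆Y z) (Z⊆Y z′) n<m))
      ... | inj₁ h↑ | inj₂ h↓̸ = Z , Z∞ , Y⊆X ∘ Z⊆Y , inj₂ λ z z′ m<n →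
          h↑ (Z⊆Y z) (Z⊆Y z′) m<n , λ eq → h↓̸ z z′ m<n (reflexive (Eq.sym eq))
      ... | inj₂ h↑̸ | inj₁ h↓ = contradiction
          (λ i → let i<1+i = enum-mono (n<1+n i) in
            h↓ (enum-∈ i) (enum-∈ (suc i)) i<1+i ,
            h↑̸ (Z⊆Y (enum-∈ i)) (Z⊆Y (enum-∈ (suc i))) i<1+i)
          (noDescent (proj₁ wqo) (h ∘ enum))
        where open Enumerate Z Z∞
      ... | inj₂ h↑̸ | inj₂ h↓̸ = contradiction (h ∘ enum , λ {i} {j} → antichain {i} {j}) (proj₂ wqo)
        where
        open Enumerate Z Z∞
        antichain : ∀ {i j} → i ≢ j → ¬ (h (enum i) ≤ᴾ h (enum j))
        antichain {i} {j} i≢j with <-cmp i j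
        ... | tri< i<j _ _ = h↑̸ (Z⊆Y (enum-∈ i)) (Z⊆Y (enum-∈ j)) (enum-mono i<j)
        ... | tri≈ _ i≡j _ = contradiction i≡j i≢j
        ... | tri> _ _ j<i = h↓̸ (enum-∈ j) (enum-∈ i) (enum-mono j<i)

      node-constant : ∀ {k f X} → Unbounded X →
        (∀ n → X n → Constant (k n) (f ∘ (n ∷_)) (X / n)) →
        UnboundedSubset X λ Y → Constant (node k) f Y ⊎ Ascends (node k) f Y
      node-constant {k} {f} {X} X∞ constant
        -- Here `h n` is the constant value below `n`; `f []` merely fills in the values outside
        -- `X`.
        with h , f≈h ← choose (f []) constant
        with constant-or-increasing h X X∞
      ... | Y , Y∞ , Y⊆X , inj₁ (p , h≈p) = Y , Y∞ , Y⊆X , inj₁ (p , λ where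
        (y ∷ b) → Eq.trans (f≈h _ (Y⊆X y) (Branch-mono (/-mono {Y} Y⊆X) b)) (h≈p y))
      -- The only branch of `leaf` is empty, and the element following it is the first label.
      ... | Y , Y∞ , Y⊆X , inj₂ h↑ = Y , Y∞ , Y⊆X , inj₂ (leaf , λ where
        [] → h , h↑ , λ where
          (y ∷ b) refl → f≈h _ (Y⊆X y) (Branch-mono (/-mono {Y} Y⊆X) b))

      -- Fusion settles the alternative below each `n`, and the pigeonhole principle makes it
      -- uniform. If `f` is constant below every `n`, the constants themselves are compared;
      -- otherwise the trees found below the labels are joined at a node.
      constant-or-ascends : ∀ T f X → Unbounded X →
        UnboundedSubset X λ Y → Constant T f Y ⊎ Ascends T f Y
      constant-or-ascends leaf f X X∞ = X , X∞ , id , inj₁ (f [] , λ { [] → Eq.refl })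
      constant-or-ascends (node k) f X X∞
        with Y , Y∞ , Y⊆X , below ← diagonalise
          (λ n Y → Constant (k n) (f ∘ (n ∷_)) Y ⊎ Ascends (k n) (f ∘ (n ∷_)) Y)
          (λ { Y⊆X (inj₁ q) → inj₁ (Constant-mono Y⊆X q)
             ; Y⊆X (inj₂ q) → inj₂ (Ascends-mono Y⊆X q) })
          (λ n → constant-or-ascends (k n) (f ∘ (n ∷_))) X X∞
        with pigeonhole (λ n → Constant (k n) (f ∘ (n ∷_)) (Y / n)) Y Y∞
      ... | Z , Z∞ , Z⊆Y , inj₁ constant
        with W , W∞ , W⊆Z , result ← node-constant Z∞
          (λ n z → Constant-mono (/-mono {Z} Z⊆Y) (constant n z))
        = W , W∞ , Y⊆X ∘ Z⊆Y ∘ W⊆Z , result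
      constant-or-ascends (node k) f X X∞
        | Z , Z∞ , Z⊆Y , inj₂ ¬constant = Z , Z∞ , Y⊆X ∘ Z⊆Y , inj₂ (node-ascends ascends)
        where
        ascends : ∀ n → Z n → Ascends (k n) (f ∘ (n ∷_)) (Z / n)
        ascends n z with below n (Z⊆Y z)
        ... | inj₁ q = contradiction q (¬constant n z)
        ... | inj₂ q = Ascends-mono (/-mono {Z} Z⊆Y) q

      -- Construction of a good pair

      module _ (bqo : BQO (Sω P)) {B} (barrier : IsBarrier B) (f : Member B → A) where
        open IsBarrier barrier

        private
          T = proj₁ (barrier-barred barrier)
          T⊆B = proj₂ (barrier-barred barrier)

          default : A
          default with em {P = ∃ B}
          ... | yes (s , s∈B) = f (s , [ s∈B ])
          ... | no B-empty = ⊥-elim (infinite ([] , λ s∈B → ⊥-elim (B-empty (_ , s∈B))))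

          -- An extension of `f` to all lists, so that the tree arguments need no membership proofs.
          f′ : List ℕ → A
          f′ s with em {P = B s}
          ... | yes s∈B = f (s , [ s∈B ])
          ... | no _    = default

          f′-≡ : ∀ {s} (s∈B : B s) → f′ s ≡ f (s , [ s∈B ])
          f′-≡ {s} s∈B with em {P = B s}
          ... | yes _   = refl
          ... | no s∉B = contradiction s∈B s∉B

          antichain-⊆ : ∀ {X} → X ⊆ ⋃ B → ∀ {s t} → Branch X T s → Branch X T t → ¬ (s ⊂ˡ t)
          antichain-⊆ X⊆ b b′ = antichain (T⊆B (Branch-mono X⊆ b)) (T⊆B (Branch-mono X⊆ b′))

          f′-good : ∀ {X s t} → X ⊆ ⋃ B → Branch X T s → Branch X T t → s ◁ t → f′ s ≤ᴾ f′ t →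
            Good preorder f
          f′-good X⊆ b b′ s◁t s≤t =
            (_ , [ s∈B ]) , (_ , [ t∈B ]) , s◁t , subst₂ _≤ᴾ_ (f′-≡ s∈B) (f′-≡ t∈B) s≤t
            where
            s∈B = T⊆B (Branch-mono X⊆ b)
            t∈B = T⊆B (Branch-mono X⊆ b′)

          constant-good : ∀ {X} → X ⊆ ⋃ B → Unbounded X → Constant T f′ X → Good preorder f
          constant-good X⊆ X∞ (p , f≈p)
            with n , _ , x ← X∞ 0
            with s , t , s◁t , b , b′ , _ ← shift-branches X∞ (antichain-⊆ X⊆) (x ∷ []) =
            f′-good X⊆ b b′ s◁t (reflexive (Eq.trans (f≈p b) (Eq.sym (f≈p b′))))

          -- Prolong `x ∷ t′ ++ m ∷ []` to a shifted pair `s ◁ s′`. Then `s` is comparable with `t`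
          -- followed by `n`, which gives the value `h n`, and `s′` with `t′` followed by `m`, which
          -- gives `h′ m`.
          ascending-good : ∀ {X x n m t t′ w} → X ⊆ ⋃ B → Unbounded X →
            ((h , _) : Ascending T f′ X t) ((h′ , _) : Ascending T f′ X t′) →
            Ascent X (x ∷ t′ ++ m ∷ []) → x ∷ t′ ≡ t ++ n ∷ w → h n ≤ᴾ h′ m →
            Good preorder f
          ascending-good {x = x} {n} {m} {t} {t′} {w} X⊆ X∞ (h , _ , f≈h) (h′ , _ , f≈h′) p eq hn≤h′m
            with s , s′ , s◁s′ , b , b′ , u , v , a , eq₁ , eq₂ ← shift-branches X∞ (antichain-⊆ X⊆) p =
            f′-good X⊆ b b′ s◁s′
              (≤ᴾ-trans (reflexive (f≈h b (trans eq₁ eq₃)))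
                (≤ᴾ-trans hn≤h′m (reflexive (Eq.sym (f≈h′ b′ (trans eq₂ (++-assoc t′ _ a)))))))
            where
            open ≡-Reasoning
            eq₃ : x ∷ (t′ ++ m ∷ []) ++ a ≡ t ++ n ∷ w ++ m ∷ a
            eq₃ = begin
              x ∷ (t′ ++ m ∷ []) ++ a ≡⟨ cong (x ∷_) (++-assoc t′ _ a) ⟩
              (x ∷ t′) ++ m ∷ a       ≡⟨ cong (_++ m ∷ a) eq ⟩
              (t ++ n ∷ w) ++ m ∷ a   ≡⟨ ++-assoc t _ _ ⟩
              t ++ n ∷ w ++ m ∷ a     ∎

          ascends-good : ∀ {X} → X ⊆ ⋃ B → Unbounded X → Ascends T f′ X → Good preorder f
          -- The empty branch alone forms no barrier, but its sequence increases, so any two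
          -- elements `x` and `m` of `X` with `x` below `m` suffice.
          ascends-good X⊆ X∞ (leaf , D↑)
            with n , _ , x ← X∞ 0
            with m , n<m , x′ ← X∞ n =
            ascending-good {t = []} {[]} X⊆ X∞ (D↑ []) (D↑ []) (x ∷ (x′ , n<m) ∷ []) refl
              (proj₁ (proj₁ (proj₂ (D↑ [])) x x′ n<m))
          ascends-good {X} X⊆ X∞ (node k , D↑)
            with Y , Y∞ , Y⊆X , antichain-Y ← thin (node k) X X∞ =
            let s , t , s◁t , s≤t = bqo (lexicographic Y (node k)) (Branch Y (node k))
                  (node-isBarrier Y∞ antichain-Y)
                  (id , (λ _ _ s<t → s<t) , λ _ t _ → t , refl)
                  (λ s → sequence (Member-∈ s))
            in conclude (Member-∈ s) (Member-∈ t) s◁t s≤t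
            where
            ascending : ∀ {t} → Branch Y (node k) t → Ascending T f′ X t
            ascending b = D↑ (Branch-mono Y⊆X b)

            module E t = Enumerate (Y // t) (//-unbounded t Y∞)

            sequence : ∀ {t} → Branch Y (node k) t → IncreasingSequence P
            sequence {t} b = let h , h↑ , _ = ascending b in
              h ∘ E.enum t , λ n → h↑ (//-mono {Y} t Y⊆X (E.enum-∈ t n))
                (//-mono {Y} t Y⊆X (E.enum-∈ t (suc n))) (E.enum-mono t (n<1+n n))

            conclude : ∀ {t t′} (b : Branch Y (node k) t) (b′ : Branch Y (node k) t′) → t ◁ t′ →
              _≤dom_ P (Terms P (sequence b)) (Terms P (sequence b′)) → Good preorder f
            conclude {t} {t′} b@(y ∷ _) b′@(_ ∷ _) (_ , x<y′ ∷ _ , (n , w , eq) , x , refl) dom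
              with refl , _ ← ∷-injective eq
              -- There is no need to locate `n` in the enumeration: the element with index `suc n`
              -- exceeds `n`, so `h n` lies below the term at that index, which `dom` bounds by a
              -- term of the second sequence.
              with q , (j , q≈) , h≤q ← dom (suc n , Eq.refl) =
              ascending-good {t = t} {t′} (X⊆ ∘ Y⊆X) Y∞
                (Ascending-mono {T} {f′} t Y⊆X (ascending b))
                (Ascending-mono {T} {f′} t′ Y⊆X (ascending b′))
                (y ∷ Ascent-raise x<y′ (Ascent-∷ʳ (Branch⇒Ascent b′) (E.enum-∈ t′ j)))
                eq
                (≤ᴾ-trans (proj₁ (h↑ (//-mono {Y} t Y⊆X n∈)
                    (//-mono {Y} t Y⊆X (E.enum-∈ t (suc n))) (E.enum-≥ t (suc n))))
                  (≤ᴾ-trans h≤q (reflexive q≈)))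
              where
              h↑ = proj₁ (proj₂ (ascending b))
              n∈ : (Y // t) n
              n∈ = prefixed t (subst (Ascent Y) eq (y ∷ Ascent-raise x<y′ (Branch⇒Ascent b′)))

        good : Good preorder f
        good with constant-or-ascends T f′ (⋃ B) (⋃-unbounded barrier)
        ... | X , X∞ , X⊆ , inj₁ constant = constant-good X⊆ X∞ constant
        ... | X , X∞ , X⊆ , inj₂ ascends  = ascends-good X⊆ X∞ ascends

theorem1p1 : (∀ {ℓ} → ExcludedMiddle ℓ) →
    ∀ {c ℓ₁ ℓ₂} (P : Poset c ℓ₁ ℓ₂) →
    WQO (Poset.preorder P) → BQO (Sω P) → BQO (Poset.preorder P)
theorem1p1 em P wqo bqo _ _ barrier _ f = Classical.good em P wqo bqo barrier f
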